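{- Let $G=(V,E)$ be a directed acyclic graph with $n$ vertices, let $S_c$ be a channel decomposition of $G$ into $k$ channels, and let $Q=(V,I)$ be the associated compressed transitive closure graph. Then the number of edges of $Q$ is $O(nk)$.
   Context: Let $G=(V,E)$ be a DAG. Here "a vertex $w$ is reached from (reachable from) $v$" means there is a directed path with at least one edge from $v$ to $w$ in $G$. A channel $C$ is an ordered set of vertices such that for any two distinct $v,w\in C$, $v$ precedes $w$ in the order of $C$ if and only if $w$ is reachable from $v$ in $G$. A channel decomposition $S_c=\{C_1,\dots,C_k\}$ is a partition of $V$ into channels. For each $v\in V$ let $L_v$ be the list of vertices such that: $L_v$ contains at most one vertex of each channel of $S_c$; and a vertex $w$ is reached from $v$ in $G$ if and only if $L_v$ contains a vertex $w'$ in the same channel as $w$ with $w'=w$ or $w'$ preceding $w$ in the order of that channel. (Thus $L_v$ consists of the lowest, i.e. first, vertex reachable from $v$ in each channel containing a vertex reachable from $v$.) The compressed transitive closure of $G$ is the set of all lists $L_v$. The compressed transitive closure graph is $Q=(V,I)$, where $(u,v)\in I$ if and only if $v\in L_u$ and $u$ is the highest (i.e. last) vertex in the order of its channel with $v\in L_u$. -}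

module Defs where

open import Data.Fin.Base using (Fin; _<_)
open import Data.Fin.Properties using (_≟_; _<?_; any?; all?)
open import Data.List.Base using (List; []; length; lookup; filter; allFin; cartesianProduct)
open import Data.List.Membership.Propositional using (_∈_)
open import Data.List.Relation.Unary.Unique.Propositional using (Unique)
open import Data.Nat.Base using (ℕ)
open import Data.Product using (_×_; ∃!; ∃-syntax; uncurry)
open import Data.Sum.Base using (_⊎_)
open import Function.Bundles using (_⇔_)
open import Level using (0ℓ)
open import Relation.Binary.Construct.Closure.Transitive using (TransClosure)
open import Relation.Binary.Core using (Rel)
open import Relation.Binary.Definitions using (Decidable)
open import Relation.Binary.PropositionalEquality.Core using (_≡_; _≢_)
open import Relation.Nullary.Decidable.Core using (_×-dec_; _⊎-dec_; _→-dec_)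
open import Relation.Nullary.Negation.Core using (¬_)

module _ {n : ℕ} where
  open import Data.List.Membership.DecPropositional (_≟_ {n}) using (_∈?_) public

record Digraph (n : ℕ) : Set₁ where
  field
    Edge  : Rel (Fin n) 0ℓ
    edge? : Decidable Edge

numEdges : ∀ {n} → Digraph n → ℕ
numEdges {n} G =
  length (filter (uncurry edge?) (cartesianProduct (allFin n) (allFin n)))
  where open Digraph G

-- `Reachable G v w` requires a path with at least one edge.
Reachable : ∀ {n} → Digraph n → Rel (Fin n) 0ℓ
Reachable G = TransClosure (Digraph.Edge G)

record DAG (n : ℕ) : Set₁ where
  field
    digraph : Digraph n
    acyclic : ∀ v → ¬ Reachable digraph v v

-- A finite ordered set of vertices is a duplicate-free list, ordered by
-- position.
Precedes : ∀ {n} → List (Fin n) → Rel (Fin n) 0ℓ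
Precedes C v w = ∃[ i ] ∃[ j ] (i < j × lookup C i ≡ v × lookup C j ≡ w)

precedes? : ∀ {n} (C : List (Fin n)) → Decidable (Precedes C)
precedes? C v w =
  any? λ i → any? λ j → i <? j ×-dec lookup C i ≟ v ×-dec lookup C j ≟ w

record IsChannel {n} (G : DAG n) (C : List (Fin n)) : Set where
  field
    unique  : Unique C
    ordered : ∀ {v w} → v ∈ C → w ∈ C → v ≢ w →
              Precedes C v w ⇔ Reachable (DAG.digraph G) v w

record ChannelDecomposition {n} (G : DAG n) (k : ℕ) : Set where
  field
    channel   : Fin k → List (Fin n)
    isChannel : ∀ c → IsChannel G (channel c)
    nonempty  : ∀ c → channel c ≢ []
    partition : ∀ v → ∃! _≡_ λ c → v ∈ channel c

module _ {n k} {G : DAG n} (S : ChannelDecomposition G k) where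
  open ChannelDecomposition S

  SameChannel : Rel (Fin n) 0ℓ
  SameChannel v w = ∃[ c ] (v ∈ channel c × w ∈ channel c)

  sameChannel? : Decidable SameChannel
  sameChannel? v w = any? λ c → v ∈? channel c ×-dec w ∈? channel c

  -- Same channel, and equal or earlier in the order of that channel.
  PrecedesOrEqual : Rel (Fin n) 0ℓ
  PrecedesOrEqual v w =
    ∃[ c ] (v ∈ channel c × w ∈ channel c × (v ≡ w ⊎ Precedes (channel c) v w))

  precedesOrEqual? : Decidable PrecedesOrEqual
  precedesOrEqual? v w = any? λ c →
    v ∈? channel c ×-dec w ∈? channel c ×-dec
    (v ≟ w ⊎-dec precedes? (channel c) v w)

  -- The conditions determine each `L v` up to the order and multiplicity of
  -- its entries.
  record CompressedTransitiveClosure : Set where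
    field
      L         : Fin n → List (Fin n)
      atMostOne : ∀ v {x y} → x ∈ L v → y ∈ L v → SameChannel x y → x ≡ y
      reaches   : ∀ v w → Reachable (DAG.digraph G) v w ⇔
                          (∃[ w′ ] (w′ ∈ L v × PrecedesOrEqual w′ w))

  module _ (T : CompressedTransitiveClosure) where
    open CompressedTransitiveClosure T

    ctcGraph : Digraph n
    ctcGraph = record
      { Edge  = λ u v → v ∈ L u ×
                  (∀ u′ → SameChannel u′ u → v ∈ L u′ → PrecedesOrEqual u′ u)
      ; edge? = λ u v → v ∈? L u ×-dec
                  all? λ u′ → sameChannel? u′ u →-dec
                              (v ∈? L u′ →-dec precedesOrEqual? u′ u)
      }

{-# OPTIONS --safe #-}

-- An edge (u , v) of the compressed transitive closure graph is determined by
-- u and the channel of v, because L u has at most one vertex in each channel.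
-- So there are at most n * k edges, and the constant is 1.
module Submission where

open import Data.Fin.Base using (Fin; zero; suc; combine)
open import Data.Fin.Properties using (combine-injective; injective⇒≤)
open import Data.List.Base using (List; allFin; cartesianProduct; filter; length; lookup)
open import Data.List.Membership.Propositional using (_∈_)
open import Data.List.Membership.Propositional.Properties using (∈-filter⁻; ∈-lookup)
import Data.List.Relation.Unary.All as All
open import Data.List.Relation.Unary.Unique.Propositional using (Unique; _∷_)
open import Data.List.Relation.Unary.Unique.Propositional.Properties
  using (allFin⁺; cartesianProduct⁺; filter⁺)
open import Data.Nat.Base using (ℕ; _*_; _≤_)
open import Data.Nat.Properties using (*-identityˡ; ≤-trans; ≤-reflexive)
open import Data.Product using (_×_; _,_; proj₁; proj₂; ∃-syntax; uncurry)
open import Relation.Nullary.Negation using (contradiction)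
open import Relation.Binary.PropositionalEquality using (_≡_; refl; cong; subst; sym)
open import Defs

-- In the mixed cases the head would recur in the tail, against `x∉xs`; otherwise induction on the
-- tail applies.
lookup-injective : ∀ {A : Set} {xs : List A} → Unique xs →
                   ∀ i j → lookup xs i ≡ lookup xs j → i ≡ j
lookup-injective (x∉xs ∷ xs!) zero    zero    eq = refl
lookup-injective (x∉xs ∷ xs!) zero    (suc j) eq = contradiction eq (All.lookup x∉xs (∈-lookup j))
lookup-injective (x∉xs ∷ xs!) (suc i) zero    eq = contradiction (sym eq) (All.lookup x∉xs (∈-lookup i))
lookup-injective (x∉xs ∷ xs!) (suc i) (suc j) eq = cong suc (lookup-injective xs! i j eq)

-- Pigeonhole: looking up a position and then applying `f` embeds `Fin (length xs)` in `Fin m`.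
-- Injectivity is asked on members only, since `f` may collide elsewhere.
length≤-injectiveOn : ∀ {A : Set} {m} {xs : List A} (f : A → Fin m) → Unique xs →
                      (∀ {x y} → x ∈ xs → y ∈ xs → f x ≡ f y → x ≡ y) →
                      length xs ≤ m
length≤-injectiveOn {xs = xs} f xs! f-inj =
  injective⇒≤ {f = λ i → f (lookup xs i)} λ {i} {j} eq →
    lookup-injective xs! i j (f-inj (∈-lookup i) (∈-lookup j) eq)

-- The edges are counted by filtering the duplicate-free list of all pairs, and every pair that
-- survives the filter is an edge.
numEdges≤-injectiveOn : ∀ {n m} (G : Digraph n) (f : Fin n × Fin n → Fin m) →
                        (∀ {e e′} → uncurry (Digraph.Edge G) e → uncurry (Digraph.Edge G) e′ →
                         f e ≡ f e′ → e ≡ e′) →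
                        numEdges G ≤ m
numEdges≤-injectiveOn {n} G f f-inj =
  length≤-injectiveOn f
    (filter⁺ edge?′ (cartesianProduct⁺ (allFin⁺ n) (allFin⁺ n)))
    λ e∈ e′∈ → f-inj (isEdge e∈) (isEdge e′∈)
  where
  edge?′ = uncurry (Digraph.edge? G)
  pairs  = cartesianProduct (allFin n) (allFin n)

  isEdge : ∀ {e} → e ∈ filter edge?′ pairs → uncurry (Digraph.Edge G) e
  isEdge e∈ = proj₂ (∈-filter⁻ edge?′ {xs = pairs} e∈)

module _ {n k} {G : DAG n} (S : ChannelDecomposition G k) where
  open ChannelDecomposition S

  channelOf : Fin n → Fin k
  channelOf v = proj₁ (partition v)

  ∈-channelOf : ∀ v → v ∈ channel (channelOf v)
  ∈-channelOf v = proj₁ (proj₂ (partition v))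

  -- Bridges the equality of channel indices, which the key yields, and the relation in which
  -- `atMostOne` is phrased.
  channelOf-≡⇒SameChannel : ∀ {v w} → channelOf v ≡ channelOf w → SameChannel S v w
  channelOf-≡⇒SameChannel {v} {w} eq =
    channelOf v , ∈-channelOf v , subst (λ c → w ∈ channel c) (sym eq) (∈-channelOf w)

  numEdges-ctcGraph≤n*k : (T : CompressedTransitiveClosure S) →
                          numEdges (ctcGraph S T) ≤ n * k
  numEdges-ctcGraph≤n*k T = numEdges≤-injectiveOn (ctcGraph S T) key key-injective
    where
    open CompressedTransitiveClosure T

    -- `combine` is the bijection from `Fin n × Fin k` to `Fin (n * k)`, so the product bound is
    -- built into the codomain.
    key : Fin n × Fin n → Fin (n * k)
    key (u , v) = combine u (channelOf v)

    key-injective : ∀ {e e′} → uncurry (Digraph.Edge (ctcGraph S T)) e →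
                    uncurry (Digraph.Edge (ctcGraph S T)) e′ → key e ≡ key e′ → e ≡ e′
    key-injective {u , v} {u′ , v′} (v∈Lu , _) (v′∈Lu′ , _) eq
      -- Matching on `refl` identifies the two sources, so both targets lie in the same list `L u`
      -- and `atMostOne` applies.
      with refl , c≡c′ ← combine-injective u (channelOf v) u′ (channelOf v′) eq =
      cong (u ,_) (atMostOne u v∈Lu v′∈Lu′ (channelOf-≡⇒SameChannel c≡c′))

theorem3 : ∃[ c ] (∀ (n k : ℕ) (G : DAG n) (S : ChannelDecomposition G k)
    (T : CompressedTransitiveClosure S) →
    numEdges (ctcGraph S T) ≤ c * (n * k))
theorem3 = 1 , λ n k G S T →
  ≤-trans (numEdges-ctcGraph≤n*k S T) (≤-reflexive (sym (*-identityˡ (n * k))))
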